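{- Let $B$ be the bull graph, i.e. the graph with vertex set $\{1,2,3,4,5\}$ and edges $\{1,3\},\{2,4\},\{3,4\},\{3,5\},\{4,5\}$ (a triangle with two disjoint pendant edges). Then $B$ is a twin-free singular graph. Let $\mathcal{A}(B)$ and $\mathcal{A}_{RW}(B)$ be the evolution algebras associated to $B$ and to the symmetric random walk on $B$, respectively. If $f:\mathcal{A}_{RW}(B)\to\mathcal{A}(B)$ is a homomorphism, then $f=0$; in particular, the two evolution algebras are not isomorphic.
   Context: A graph is singular if its adjacency matrix is singular, and twin-free if no two distinct vertices have the same set of neighbors. Algebras are over a field $\mathbb{K}$. The algebra $\mathcal{A}(B)$ has basis $e_1,\dots,e_5$ and bilinear product determined by $e_1^2=e_3$, $e_2^2=e_4$, $e_3^2=e_1+e_4+e_5$, $e_4^2=e_2+e_3+e_5$, $e_5^2=e_3+e_4$, and $e_i\cdot e_j=0$ if $i\neq j$. The algebra $\mathcal{A}_{RW}(B)$ has basis $e_1,\dots,e_5$ and bilinear product determined by $e_1^2=e_3$, $e_2^2=e_4$, $e_3^2=\frac13(e_1+e_4+e_5)$, $e_4^2=\frac13(e_2+e_3+e_5)$, $e_5^2=\frac12(e_3+e_4)$, and $e_i\cdot e_j=0$ if $i\neq j$. An algebra homomorphism is a $\mathbb{K}$-linear map $f$ with $f(xy)=f(x)f(y)$ for all $x,y$; an isomorphism is a bijective homomorphism.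
   Formalization: The claim f=0 is stated under the added assumption that −1 is not a square in K (it fails otherwise, e.g. over ℂ); 2 and 3 are assumed invertible in K so that A_RW(B) is defined; non-isomorphism is proved without the assumption on −1. -}

module Defs where

open import Level using (_⊔_; 0ℓ; suc)
open import Algebra.Apartness.Bundles using (HeytingField; HeytingCommutativeRing)
open import Algebra.Bundles using (CommutativeRing; Semiring)
open import Algebra.Core using (Op₂)
import Algebra.Definitions.RawSemiring as RawSemiringDefinitions
open import Algebra.Module.Bundles.Raw using (RawLeftModule)
open import Algebra.Module.Morphism.Structures using (IsLeftModuleHomomorphism)
import Algebra.Morphism.Definitions as MorphismDefinitions
open import Data.Bool.Base using (if_then_else_)
open import Data.Fin.Base using (Fin; toℕ; punchIn) renaming (zero to fzero; suc to fsuc)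
open import Data.Fin.Patterns
open import Data.Fin.Properties using (all?) renaming (_≟_ to _≟ᶠ_)
open import Data.Integer.Base as ℤ using (ℤ; 0ℤ; 1ℤ; -1ℤ)
open import Data.List.Base using (List; []; _∷_; length; filter; allFin)
open import Data.Nat.Base as ℕ using (ℕ)
open import Data.Product.Base using (Σ-syntax; ∃-syntax; _×_; _,_; proj₁)
open import Data.Product.Properties using (≡-dec)
open import Data.Sum.Base using (_⊎_; swap)
open import Data.Vec.Functional using (Vector)
open import Function.Bundles using (_⇔_)
open import Function.Definitions using (Bijective)
open import Relation.Binary.Core using (Rel)
open import Relation.Binary.Definitions using (Symmetric; Decidable)
open import Relation.Binary.PropositionalEquality.Core using (_≡_; _≢_)
open import Relation.Nullary.Decidable using (does; ¬?; _⊎-dec_; toWitness)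
open import Relation.Nullary.Negation.Core using (¬_)

record Graph (n : ℕ) : Set₁ where
  infix 4 _~_ _~?_
  field
    _~_      : Rel (Fin n) 0ℓ
    _~?_     : Decidable _~_
    ~-sym    : Symmetric _~_
    ~-irrefl : ∀ i → ¬ i ~ i

  degree : Fin n → ℕ
  degree i = length (filter (i ~?_) (allFin n))

TwinFree : ∀ {n} → Graph n → Set
TwinFree {n} G = ∀ (i j : Fin n) → i ≢ j → ¬ (∀ k → (i ~ k) ⇔ (j ~ k))
  where open Graph G

module _ where
  open RawSemiringDefinitions ℤ.+-*-rawSemiring using (sum)

  -- Laplace expansion along the first row.
  det : ∀ {n} → (Fin n → Fin n → ℤ) → ℤ
  det {ℕ.zero}  M = 1ℤ
  det {ℕ.suc n} M = sum λ j →
    (-1ℤ ℤ.^ toℕ j) ℤ.* M fzero j ℤ.* det (λ i k → M (fsuc i) (punchIn j k))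

adjacencyMatrix : ∀ {n} → Graph n → Fin n → Fin n → ℤ
adjacencyMatrix G i j = if does (i ~? j) then 1ℤ else 0ℤ
  where open Graph G

Singular : ∀ {n} → Graph n → Set
Singular G = det (adjacencyMatrix G) ≡ 0ℤ

-- The vertices 1, …, 5 are 0F, …, 4F.
bullEdges : List (Fin 5 × Fin 5)
bullEdges = (0F , 2F) ∷ (1F , 3F) ∷ (2F , 3F) ∷ (2F , 4F) ∷ (3F , 4F) ∷ []

module _ where
  open import Data.List.Membership.DecPropositional (≡-dec (_≟ᶠ_ {5}) (_≟ᶠ_ {5})) using (_∈_; _∈?_)

  private
    _~ᴮ_ : Rel (Fin 5) 0ℓ
    i ~ᴮ j = (i , j) ∈ bullEdges ⊎ (j , i) ∈ bullEdges

    _~ᴮ?_ : Decidable _~ᴮ_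
    i ~ᴮ? j = ((i , j) ∈? bullEdges) ⊎-dec ((j , i) ∈? bullEdges)

  bull : Graph 5
  bull = record
    { _~_      = _~ᴮ_
    ; _~?_     = _~ᴮ?_
    ; ~-sym    = swap
    ; ~-irrefl = toWitness {a? = all? (λ i → ¬? (i ~ᴮ? i))} _
    }

-- HeytingField is the standard library's notion of field.  By tightness of the
-- apartness, x # y is classically just ¬ (x ≈ y), so classically these are
-- exactly the fields.
module OverField {c ℓ₁ ℓ₂} (K : HeytingField c ℓ₁ ℓ₂) where

  open HeytingField K hiding (zero)
  open CommutativeRing (HeytingCommutativeRing.commutativeRing heytingCommutativeRing)
    using (semiring)
  open RawSemiringDefinitions (Semiring.rawSemiring semiring) using (sum) renaming (_×_ to _·ℕ_)

  fromℕ : ℕ → Carrier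
  fromℕ n = n ·ℕ 1#

  -- #⇒invertible yields the inverse of x - 0#.
  inverse : ∀ {x} → x # 0# → Carrier
  inverse x#0 = proj₁ (#⇒invertible x#0)

  record RawAlgebra m ℓm : Set (c ⊔ suc (m ⊔ ℓm)) where
    infixl 7 _∙_
    field
      rawLeftModule : RawLeftModule Carrier m ℓm
    open RawLeftModule rawLeftModule public
    field
      _∙_ : Op₂ Carrierᴹ

  module _ {m₁ ℓm₁ m₂ ℓm₂} (A : RawAlgebra m₁ ℓm₁) (B : RawAlgebra m₂ ℓm₂) where
    private
      module A = RawAlgebra A
      module B = RawAlgebra B

    record IsAlgebraHomomorphism (f : A.Carrierᴹ → B.Carrierᴹ) : Set (c ⊔ m₁ ⊔ ℓm₁ ⊔ ℓm₂) where
      open MorphismDefinitions A.Carrierᴹ B.Carrierᴹ B._≈ᴹ_ using (Homomorphic₂)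
      field
        isLeftModuleHomomorphism : IsLeftModuleHomomorphism A.rawLeftModule B.rawLeftModule f
        ∙-homo                   : Homomorphic₂ f A._∙_ B._∙_

      open IsLeftModuleHomomorphism isLeftModuleHomomorphism public

    record IsAlgebraIsomorphism (f : A.Carrierᴹ → B.Carrierᴹ) : Set (c ⊔ m₁ ⊔ m₂ ⊔ ℓm₁ ⊔ ℓm₂) where
      field
        isAlgebraHomomorphism : IsAlgebraHomomorphism f
        bijective             : Bijective A._≈ᴹ_ B._≈ᴹ_ f

      open IsAlgebraHomomorphism isAlgebraHomomorphism public

    Isomorphic : Set (c ⊔ m₁ ⊔ m₂ ⊔ ℓm₁ ⊔ ℓm₂)
    Isomorphic = Σ[ f ∈ (A.Carrierᴹ → B.Carrierᴹ) ] IsAlgebraIsomorphism f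

  -- The evolution algebra Kⁿ with natural basis e₁, …, eₙ (the standard basis),
  -- eᵢ ∙ eᵢ = Σₖ C i k eₖ and eᵢ ∙ eⱼ = 0 for i ≠ j; a vector is its family of
  -- coordinates, so bilinearity gives (x ∙ y)ₖ = Σᵢ xᵢ yᵢ C i k.
  evolutionAlgebra : ∀ {n} → (Fin n → Fin n → Carrier) → RawAlgebra c ℓ₁
  evolutionAlgebra {n} C = record
    { rawLeftModule = record
      { Carrierᴹ = Vector Carrier n
      ; _≈ᴹ_     = λ x y → ∀ k → x k ≈ y k
      ; _+ᴹ_     = λ x y k → x k + y k
      ; _*ₗ_     = λ a x k → a * x k
      ; 0ᴹ       = λ _ → 0#
      ; -ᴹ_      = λ x k → - x k
      }
    ; _∙_ = λ x y k → sum λ i → x i * y i * C i k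
    }

  -- eᵢ² = Σ_{k ~ i} eₖ
  graphAlgebra : ∀ {n} → Graph n → RawAlgebra c ℓ₁
  graphAlgebra G = evolutionAlgebra λ i k → if does (i ~? k) then 1# else 0#
    where open Graph G

  -- eᵢ² = (1 / degree i) Σ_{k ~ i} eₖ: the weights are the transition
  -- probabilities of the symmetric random walk.
  randomWalkAlgebra : ∀ {n} (G : Graph n) →
    (∀ i → fromℕ (Graph.degree G i) # 0#) → RawAlgebra c ℓ₁
  randomWalkAlgebra G degree#0 =
    evolutionAlgebra λ i k → if does (i ~? k) then inverse (degree#0 i) else 0#
    where open Graph G

  private
    1#0 : fromℕ 1 # 0#
    1#0 = invertible⇒# (1# , trans (*-identityˡ _) eq , trans (*-identityʳ _) eq)
      where
      eq : fromℕ 1 - 0# ≈ 1#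
      eq = trans (+-cong (+-identityʳ 1#) (trans (sym (+-identityˡ (- 0#))) (-‿inverseʳ 0#)))
                 (+-identityʳ 1#)

  -- The degrees in the bull are 1, 1, 3, 3, 2, so its random walk algebra makes
  -- sense exactly when the characteristic is neither 2 nor 3.
  bullDegree#0 : fromℕ 2 # 0# → fromℕ 3 # 0# → ∀ i → fromℕ (Graph.degree bull i) # 0#
  bullDegree#0 2#0 3#0 0F = 1#0
  bullDegree#0 2#0 3#0 1F = 1#0
  bullDegree#0 2#0 3#0 2F = 3#0
  bullDegree#0 2#0 3#0 3F = 3#0
  bullDegree#0 2#0 3#0 4F = 2#0

  -- If ι * ι ≈ - 1#, then v = e₁ + e₂ + ι e₅ has v ∙ v = 0 in graphAlgebra bull,
  -- and e₁, e₂ ↦ v, e₅ ↦ - v, e₃, e₄ ↦ 0 is a nonzero homomorphism from the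
  -- random walk algebra; hence homomorphisms vanish only if - 1# is not a square.
  IsSquare : Carrier → Set (c ⊔ ℓ₁)
  IsSquare a = ∃[ x ] x * x ≈ a

{-# OPTIONS --safe #-}

-- Write uᵢ = f(eᵢ), and number vertices and coordinates from 0 as in Fin 5.
-- Orthogonality of the uᵢ together with 2 u₄² = u₂ + u₃ kills the coordinates
-- 2 and 3 of u₀, u₁, u₄, so u₂ = u₀² and u₃ = u₁² are supported on the
-- coordinates 2 and 3.  If s = (u₂)₂ were nonzero, the remaining relations would
-- force (u₄)₄ = (u₃)₃ = 3s² and s = 3 (u₃)₃² = 2 (u₄)₄², hence s = 0.  The
-- reflection of the bull deals with (u₂)₃ in the same way, so u₂ = u₃ = 0
-- whether or not - 1 is a square, and f is not injective.  The other coordinates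
-- of u₀, u₁, u₄ then solve equations x² + y² = 0, so they vanish when - 1 is not
-- a square.
module Submission where

open import Defs
open import Algebra.Apartness.Bundles using (HeytingField; HeytingCommutativeRing)
open import Algebra.Bundles using (CommutativeRing)
import Algebra.Apartness.Properties.HeytingCommutativeRing as ApartnessProperties
import Algebra.Properties.CommutativeMonoid.Sum as CommutativeMonoidSum
import Algebra.Properties.Ring as RingProperties
import Algebra.Solver.Ring.NaturalCoefficients.Default as NaturalCoefficients
open import Data.Bool.Base using (if_then_else_)
open import Data.Fin.Base using (Fin; suc)
open import Data.Fin.Patterns
open import Data.Fin.Properties using (all?; punchInᵢ≢i; _≟_)
open import Data.Nat.Base as ℕ using (ℕ)
open import Data.Product.Base using (_×_; _,_; proj₁; proj₂)
open import Data.Vec.Functional using (Vector)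
open import Function.Base using (_∘_; flip)
open import Function.Bundles using (mk⇔; module Equivalence)
open import Relation.Binary.PropositionalEquality as ≡ using (_≡_; _≢_)
import Relation.Binary.Reasoning.Setoid as ≈-Reasoning
open import Relation.Nullary.Decidable
  using (yes; no; does; ¬?; _×-dec_; _→-dec_; toWitness; dec-true; dec-false; does-⇔)
open import Relation.Nullary.Negation.Core using (¬_; contradiction)

-- The bull is twin-free and singular

bull-twinFree : TwinFree bull
-- Exhaustive check over the five vertices. The equivalence is split into two implications so that
-- the decision combinators apply.
bull-twinFree i j i≢j same = toWitness {a? = separated?} _ i j i≢j
  λ k → Equivalence.to (same k) , Equivalence.from (same k)
  where
  open Graph bull
  separated? = all? λ i → all? λ j → ¬? (i ≟ j) →-dec
    ¬? (all? λ k → (i ~? k →-dec j ~? k) ×-dec (j ~? k →-dec i ~? k))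

-- The Laplace expansion evaluates to zero; the vector (1, 1, 0, 0, -1) lies in the kernel.
bull-singular : Singular bull
bull-singular = ≡.refl

module _ {ℓ₀ ℓ₁ ℓ₂} (K : HeytingField ℓ₀ ℓ₁ ℓ₂) where

  open HeytingField K
  open OverField K
  open HeytingCommutativeRing heytingCommutativeRing using (commutativeRing)
  open CommutativeRing commutativeRing
    using (ring; commutativeSemiring; +-commutativeMonoid)
  open ApartnessProperties heytingCommutativeRing
  open RingProperties ring using (+-cancelˡ; +-inverseʳ-unique; -‿distribˡ-*)
  open CommutativeMonoidSum +-commutativeMonoid
    using (sum; sum-remove; sum-cong-≋; sum-replicate-zero)
  open NaturalCoefficients commutativeSemiring
    using (solve; con; _:+_; _:*_; _:=_)
  open ≈-Reasoning setoid

  private variable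
    n : ℕ
    x y z : Carrier

  -- Fields

  -- Equality with zero is not assumed decidable, so each case split on whether an element vanishes
  -- takes this form: assume it apart from zero and refute that.
  ¬#⇒≈ : ¬ x # y → x ≈ y
  ¬#⇒≈ = proj₁ (tight _ _)

  ≈⇒¬# : x ≈ y → ¬ x # y
  ≈⇒¬# = proj₂ (tight _ _)

  inverse-inverseʳ : (x#0 : x # 0#) → x * inverse x#0 ≈ 1#
  inverse-inverseʳ x#0 =
    trans (*-congʳ (sym (x-0≈x _))) (proj₂ (proj₂ (#⇒invertible x#0)))

  xy≈0∧x#0⇒y≈0 : x * y ≈ 0# → x # 0# → y ≈ 0#
  xy≈0∧x#0⇒y≈0 xy≈0 x#0 = ¬#⇒≈ λ y#0 → ≈⇒¬# xy≈0 (x#0y#0→xy#0 x#0 y#0)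

  xx≈0⇒x≈0 : x * x ≈ 0# → x ≈ 0#
  xx≈0⇒x≈0 xx≈0 = ¬#⇒≈ λ x#0 → ≈⇒¬# xx≈0 (x#0y#0→xy#0 x#0 x#0)

  x≈0⇒xy≈0 : x ≈ 0# → x * y ≈ 0#
  x≈0⇒xy≈0 x≈0 = trans (*-congʳ x≈0) (zeroˡ _)

  y≈0⇒xy≈0 : y ≈ 0# → x * y ≈ 0#
  y≈0⇒xy≈0 y≈0 = trans (*-congˡ y≈0) (zeroʳ _)

  x≈0⇒x+y≈y : x ≈ 0# → x + y ≈ y
  x≈0⇒x+y≈y x≈0 = trans (+-congʳ x≈0) (+-identityˡ _)

  y≈0⇒x+y≈x : y ≈ 0# → x + y ≈ x
  y≈0⇒x+y≈x y≈0 = trans (+-congˡ y≈0) (+-identityʳ _)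

  sumOfSquares-anisotropic : ¬ IsSquare (- 1#) → x * x + y * y ≈ 0# → x ≈ 0#
  sumOfSquares-anisotropic {x} {y} nonsquare xx+yy≈0 = ¬#⇒≈ λ x#0 →
    let r  = inverse x#0
        rx = trans (*-comm r x) (inverse-inverseʳ x#0)
    -- The witness is y / x: dividing x² + y² = 0 by x² gives 1 + (y / x)² = 0.
    in nonsquare (r * y , +-inverseʳ-unique 1# _ (begin
      1# + r * y * (r * y)                 ≈⟨ +-congʳ (trans (*-cong rx rx) (*-identityˡ 1#)) ⟨
      r * x * (r * x) + r * y * (r * y)    ≈⟨ solve 3 (λ r x y →
        r :* x :* (r :* x) :+ r :* y :* (r :* y) := r :* r :* (x :* x :+ y :* y)) refl r x y ⟩
      r * r * (x * x + y * y)              ≈⟨ y≈0⇒xy≈0 xx+yy≈0 ⟩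
      0#                                   ∎))

  -- Homomorphisms of evolution algebras

  sum-single : ∀ (i : Fin n) t → (∀ j → j ≢ i → t j ≈ 0#) → sum t ≈ t i
  sum-single {ℕ.suc n} i t off = begin
    sum t                                  ≈⟨ sum-remove {i = i} t ⟩
    t i + _                                ≈⟨ +-congˡ (sum-cong-≋ λ j → off _ (punchInᵢ≢i i j)) ⟩
    t i + _                                ≈⟨ y≈0⇒x+y≈x (sum-replicate-zero n) ⟩
    t i                                    ∎

  basis : Fin n → Vector Carrier n
  basis i k = if does (i ≟ k) then 1# else 0#

  basis-diagonal : ∀ (i : Fin n) → basis i i ≈ 1#
  basis-diagonal i rewrite dec-true (i ≟ i) ≡.refl = refl

  basis-offDiagonal : ∀ {i j : Fin n} → i ≢ j → basis i j ≈ 0#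
  basis-offDiagonal {i = i} {j} i≢j rewrite dec-false (i ≟ j) i≢j = refl

  basis-expansion : ∀ (x : Vector Carrier n) k → sum (λ i → x i * basis i k) ≈ x k
  basis-expansion x k = begin
    sum (λ i → x i * basis i k) ≈⟨ sum-single k _ (λ j j≢k → y≈0⇒xy≈0 (basis-offDiagonal j≢k)) ⟩
    x k * basis k k             ≈⟨ *-congˡ (basis-diagonal k) ⟩
    x k * 1#                    ≈⟨ *-identityʳ (x k) ⟩
    x k                         ∎

  module _ (C : Fin n → Fin n → Carrier) where
    open RawAlgebra (evolutionAlgebra C) using (_≈ᴹ_; 0ᴹ; _∙_)

    basis-orthogonal : ∀ {i j} → i ≢ j → basis i ∙ basis j ≈ᴹ 0ᴹ
    basis-orthogonal {i} {j} i≢j k =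
      trans (sum-cong-≋ λ l → x≈0⇒xy≈0 (product l)) (sum-replicate-zero n)
      where
      product : ∀ l → basis i l * basis j l ≈ 0#
      product l with i ≟ l
      ... | yes ≡.refl = y≈0⇒xy≈0 (basis-offDiagonal (i≢j ∘ ≡.sym))
      ... | no _       = zeroˡ _

    basis-square : ∀ i → basis i ∙ basis i ≈ᴹ C i
    basis-square i k = begin
      sum (λ l → basis i l * basis i l * C l k) ≈⟨ sum-single i _ (λ l l≢i →
        x≈0⇒xy≈0 (x≈0⇒xy≈0 (basis-offDiagonal (l≢i ∘ ≡.sym)))) ⟩
      basis i i * basis i i * C i k ≈⟨ *-congʳ (*-cong (basis-diagonal i) (basis-diagonal i)) ⟩
      1# * 1# * C i k               ≈⟨ solve 1 (λ x → con 1 :* con 1 :* x := x) refl (C i k) ⟩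
      C i k                         ∎

  module Homomorphism {m} (C : Fin n → Fin n → Carrier) (D : Fin m → Fin m → Carrier)
    {f : Vector Carrier n → Vector Carrier m}
    (f-homo : IsAlgebraHomomorphism (evolutionAlgebra C) (evolutionAlgebra D) f) where

    open IsAlgebraHomomorphism f-homo
    open RawAlgebra (evolutionAlgebra D) using (_≈ᴹ_; 0ᴹ; _∙_)

    image : Fin n → Vector Carrier m
    image = f ∘ basis

    -- The number `p` of summands is kept separate from the dimension `n`, so that the induction
    -- shortens the sum while the ambient space stays fixed.
    f-sum : ∀ {p} (x : Vector Carrier p) (v : Fin p → Vector Carrier n) l →
      f (λ k → sum λ i → x i * v i k) l ≈ sum λ i → x i * f (v i) l
    f-sum {ℕ.zero}  x v l = 0ᴹ-homo l
    f-sum {ℕ.suc p} x v l = trans (+ᴹ-homo _ _ l)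
      (+-cong (*ₗ-homo _ _ l) (f-sum (x ∘ suc) (v ∘ suc) l))

    f-expansion : ∀ x l → f x l ≈ sum λ i → x i * image i l
    f-expansion x l = trans (sym (⟦⟧-cong (basis-expansion x) l)) (f-sum x basis l)

    image-orthogonal : ∀ {i j} → i ≢ j → image i ∙ image j ≈ᴹ 0ᴹ
    image-orthogonal {i} {j} i≢j l = trans (sym (∙-homo (basis i) (basis j) l))
      (trans (⟦⟧-cong (basis-orthogonal C i≢j) l) (0ᴹ-homo l))

    image-square : ∀ i → image i ∙ image i ≈ᴹ f (C i)
    image-square i l = trans (sym (∙-homo (basis i) (basis i) l)) (⟦⟧-cong (basis-square C i) l)

  -- Structure constants of the graph and random walk algebras

  adjacency : Graph n → Fin n → Fin n → Carrier
  adjacency G i k = if does (i ~? k) then 1# else 0#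
    where open Graph G

  adjacency-sym : ∀ (G : Graph n) i k → adjacency G i k ≡ adjacency G k i
  adjacency-sym G i k = ≡.cong (if_then 1# else 0#)
    (does-⇔ (mk⇔ ~-sym ~-sym) (i ~? k) (k ~? i))
    where open Graph G

  transition : ∀ (G : Graph n) → (∀ i → fromℕ (Graph.degree G i) # 0#) → Fin n → Fin n → Carrier
  transition G degree#0 i k = if does (i ~? k) then inverse (degree#0 i) else 0#
    where open Graph G

  module _ (G : Graph n) (degree#0 : ∀ i → fromℕ (Graph.degree G i) # 0#)
    {m} (D : Fin m → Fin m → Carrier) {f}
    (f-homo : IsAlgebraHomomorphism (randomWalkAlgebra G degree#0) (evolutionAlgebra D) f) where

    open Graph G
    open Homomorphism (transition G degree#0) D f-homo
    open IsAlgebraHomomorphism f-homo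
    open RawAlgebra (evolutionAlgebra D) using (_∙_)

    degree*transition : ∀ i k →
      fromℕ (degree i) * transition G degree#0 i k ≈ adjacency G i k
    degree*transition i k with i ~? k
    ... | yes _ = inverse-inverseʳ (degree#0 i)
    ... | no _  = zeroʳ _

    -- Multiplying by the degree clears the inverse, leaving natural number coefficients. Symmetry
    -- of the adjacency matrix puts the right side in the same form as the product in the graph
    -- algebra, so one evaluation of such sums serves both.
    degree*image-square : ∀ i l →
      fromℕ (degree i) * (image i ∙ image i) l ≈ sum λ k → image k l * adjacency G k i
    degree*image-square i l = begin
      fromℕ (degree i) * (image i ∙ image i) l ≈⟨ *-congˡ (image-square i l) ⟩
      fromℕ (degree i) * f _ l                 ≈⟨ *ₗ-homo (fromℕ (degree i)) _ l ⟨
      f (λ k → fromℕ (degree i) * _) l         ≈⟨ ⟦⟧-cong (degree*transition i) l ⟩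
      f (adjacency G i) l                      ≈⟨ f-expansion (adjacency G i) l ⟩
      sum (λ k → adjacency G i k * image k l)  ≈⟨ sum-cong-≋ (λ k →
        trans (*-comm _ _) (*-congˡ (reflexive (adjacency-sym G i k)))) ⟩
      sum (λ k → image k l * adjacency G k i)  ∎

  -- The bull

  neighbourSum : Vector Carrier 5 → Vector Carrier 5
  neighbourSum w 0F = w 2F
  neighbourSum w 1F = w 3F
  neighbourSum w 2F = w 0F + w 3F + w 4F
  neighbourSum w 3F = w 1F + w 2F + w 4F
  neighbourSum w 4F = w 2F + w 3F

  sum-adjacency-bull : ∀ w k → sum (λ i → w i * adjacency bull i k) ≈ neighbourSum w k
  sum-adjacency-bull w 0F = solve 5 (λ a b c d e →
    a :* con 0 :+ (b :* con 0 :+ (c :* con 1 :+ (d :* con 0 :+ (e :* con 0 :+ con 0)))) := c)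
    refl (w 0F) (w 1F) (w 2F) (w 3F) (w 4F)
  sum-adjacency-bull w 1F = solve 5 (λ a b c d e →
    a :* con 0 :+ (b :* con 0 :+ (c :* con 0 :+ (d :* con 1 :+ (e :* con 0 :+ con 0)))) := d)
    refl (w 0F) (w 1F) (w 2F) (w 3F) (w 4F)
  sum-adjacency-bull w 2F = solve 5 (λ a b c d e →
    a :* con 1 :+ (b :* con 0 :+ (c :* con 0 :+ (d :* con 1 :+ (e :* con 1 :+ con 0))))
      := a :+ d :+ e)
    refl (w 0F) (w 1F) (w 2F) (w 3F) (w 4F)
  sum-adjacency-bull w 3F = solve 5 (λ a b c d e →
    a :* con 0 :+ (b :* con 1 :+ (c :* con 1 :+ (d :* con 0 :+ (e :* con 1 :+ con 0))))
      := b :+ c :+ e)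
    refl (w 0F) (w 1F) (w 2F) (w 3F) (w 4F)
  sum-adjacency-bull w 4F = solve 5 (λ a b c d e →
    a :* con 0 :+ (b :* con 0 :+ (c :* con 1 :+ (d :* con 1 :+ (e :* con 0 :+ con 0))))
      := c :+ d)
    refl (w 0F) (w 1F) (w 2F) (w 3F) (w 4F)

  -- Quadratic relations among the images, and the reflection

  infixl 7 _⊙_
  _⊙_ : Vector Carrier 5 → Vector Carrier 5 → Vector Carrier 5
  x ⊙ y = neighbourSum λ i → x i * y i

  -- Holds everything about the images of the basis that the vanishing argument uses. Stating it for
  -- an arbitrary family lets the argument run on the reflected family too.
  record BullRelations (u : Fin 5 → Vector Carrier 5) : Set ℓ₁ where
    field
      orthogonal : ∀ {i j} → i ≢ j → ∀ l → (u i ⊙ u j) l ≈ 0#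
      square     : ∀ i l →
        fromℕ (Graph.degree bull i) * (u i ⊙ u i) l ≈ neighbourSum (flip u l) i

  reflect : Fin 5 → Fin 5
  reflect 0F = 1F
  reflect 1F = 0F
  reflect 2F = 3F
  reflect 3F = 2F
  reflect 4F = 4F

  ⊙-reflect : ∀ x y l → ((x ∘ reflect) ⊙ (y ∘ reflect)) l ≈ (x ⊙ y) (reflect l)
  ⊙-reflect x y 0F = refl
  ⊙-reflect x y 1F = refl
  ⊙-reflect x y 2F = refl
  ⊙-reflect x y 3F = refl
  ⊙-reflect x y 4F = +-comm _ _

  -- The reflection induces an automorphism of the target algebra. Only coordinates are permuted;
  -- the indices of the images, and hence the degrees, stay put.
  reflectRelations : ∀ {u} → BullRelations u → BullRelations (λ i → u i ∘ reflect)
  reflectRelations r = record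
    { orthogonal = λ i≢j l → trans (⊙-reflect _ _ l) (orthogonal i≢j (reflect l))
    ; square     = λ i l → trans (*-congˡ (⊙-reflect _ _ l)) (square i (reflect l))
    }
    where open BullRelations r

  -- If z were apart from zero, then x and y would vanish, giving 2z² = 0. So z = 0 and x² + y² = 0;
  -- since xy = 0, this forces both to vanish even when - 1 is a square.
  orthogonal⇒≈0 : fromℕ 2 # 0# → x * y ≈ 0# → z * x ≈ 0# → z * y ≈ 0# →
    fromℕ 2 * (z * z) ≈ x * x + y * y → x ≈ 0# × y ≈ 0# × z ≈ 0#
  orthogonal⇒≈0 {x} {y} {z} 2#0 xy≈0 zx≈0 zy≈0 2zz≈xx+yy =
    x≈0 , xx≈0⇒x≈0 (trans (sym (x≈0⇒x+y≈y (x≈0⇒xy≈0 x≈0))) xx+yy≈0) , z≈0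
    where
    z≈0 : z ≈ 0#
    z≈0 = ¬#⇒≈ λ z#0 → ≈⇒¬# (xx≈0⇒x≈0 (xy≈0∧x#0⇒y≈0 (trans 2zz≈xx+yy
      (trans (x≈0⇒x+y≈y (x≈0⇒xy≈0 (xy≈0∧x#0⇒y≈0 zx≈0 z#0)))
             (x≈0⇒xy≈0 (xy≈0∧x#0⇒y≈0 zy≈0 z#0)))) 2#0)) z#0

    xx+yy≈0 : x * x + y * y ≈ 0#
    xx+yy≈0 = trans (sym 2zz≈xx+yy) (y≈0⇒xy≈0 (x≈0⇒xy≈0 z≈0))

    x≈0 : x ≈ 0#
    x≈0 = ¬#⇒≈ λ x#0 → ≈⇒¬# (xx≈0⇒x≈0
      (trans (sym (y≈0⇒x+y≈x (x≈0⇒xy≈0 (xy≈0∧x#0⇒y≈0 xy≈0 x#0)))) xx+yy≈0)) x#0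

  module Relations {u} (r : BullRelations u) where
    open BullRelations r

    -- The letter names the coordinate and the argument the image; in lemma names the argument
    -- becomes a subscript.
    a b c d e : Fin 5 → Carrier
    a i = u i 0F
    b i = u i 1F
    c i = u i 2F
    d i = u i 3F
    e i = u i 4F

    u₀² : ∀ l → (u 0F ⊙ u 0F) l ≈ u 2F l
    -- Vertex 0 has degree 1, and `fromℕ 1` unfolds to `1# + 0#`.
    u₀² l = trans (solve 1 (λ x → x := (con 1 :+ con 0) :* x) refl _) (square 0F l)

    u₁² : ∀ l → (u 1F ⊙ u 1F) l ≈ u 3F l
    u₁² l = trans (solve 1 (λ x → x := (con 1 :+ con 0) :* x) refl _) (square 1F l)

    -- Vertex 0 is pendant at vertex 2, so coordinate 0 of a product is the product of the
    -- coordinates 2. There the relation for u₄ reads 2c₄² = a₂ + a₃ = c₀² + c₁².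
    c₀c₁c₄≈0 : fromℕ 2 # 0# → c 0F ≈ 0# × c 1F ≈ 0# × c 4F ≈ 0#
    c₀c₁c₄≈0 2#0 = orthogonal⇒≈0 2#0
      (orthogonal {0F} {1F} (λ ()) 0F) (orthogonal {4F} {0F} (λ ()) 0F)
      (orthogonal {4F} {1F} (λ ()) 0F)
      (trans (square 4F 0F) (sym (+-cong (u₀² 0F) (u₁² 0F))))

  -- Coordinates that vanish whether or not - 1 is a square

  module Vanishing (2#0 : fromℕ 2 # 0#) (3#0 : fromℕ 3 # 0#) {u} (r : BullRelations u) where
    open BullRelations r
    open Relations r

    c₀≈0 : c 0F ≈ 0#
    c₀≈0 = proj₁ (c₀c₁c₄≈0 2#0)
    c₁≈0 : c 1F ≈ 0#
    c₁≈0 = proj₁ (proj₂ (c₀c₁c₄≈0 2#0))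
    c₄≈0 : c 4F ≈ 0#
    c₄≈0 = proj₂ (proj₂ (c₀c₁c₄≈0 2#0))

    module Reflected = Relations (reflectRelations r)

    d₀≈0 : d 0F ≈ 0#
    d₀≈0 = proj₁ (Reflected.c₀c₁c₄≈0 2#0)
    d₁≈0 : d 1F ≈ 0#
    d₁≈0 = proj₁ (proj₂ (Reflected.c₀c₁c₄≈0 2#0))
    d₄≈0 : d 4F ≈ 0#
    d₄≈0 = proj₂ (proj₂ (Reflected.c₀c₁c₄≈0 2#0))

    a₂≈0 : a 2F ≈ 0#
    a₂≈0 = trans (sym (u₀² 0F)) (x≈0⇒xy≈0 c₀≈0)
    b₂≈0 : b 2F ≈ 0#
    b₂≈0 = trans (sym (u₀² 1F)) (x≈0⇒xy≈0 d₀≈0)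
    e₂≈0 : e 2F ≈ 0#
    e₂≈0 = trans (sym (u₀² 4F)) (trans (x≈0⇒x+y≈y (x≈0⇒xy≈0 c₀≈0)) (x≈0⇒xy≈0 d₀≈0))
    a₃≈0 : a 3F ≈ 0#
    a₃≈0 = trans (sym (u₁² 0F)) (x≈0⇒xy≈0 c₁≈0)
    b₃≈0 : b 3F ≈ 0#
    b₃≈0 = trans (sym (u₁² 1F)) (x≈0⇒xy≈0 d₁≈0)
    e₃≈0 : e 3F ≈ 0#
    e₃≈0 = trans (sym (u₁² 4F)) (trans (x≈0⇒x+y≈y (x≈0⇒xy≈0 c₁≈0)) (x≈0⇒xy≈0 d₁≈0))

    only-middle : x ≈ 0# → z ≈ 0# → x + y + z ≈ y
    only-middle x≈0 z≈0 = trans (y≈0⇒x+y≈x z≈0) (x≈0⇒x+y≈y x≈0)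

    only-last : x ≈ 0# → y ≈ 0# → x + y + z ≈ z
    only-last x≈0 y≈0 = trans (+-congʳ (x≈0⇒x+y≈y x≈0)) (x≈0⇒x+y≈y y≈0)

    -- Vertex 2 has neighbours 0, 3, 4. On the left the coordinates 0 and 4 of u₂ vanish, on the
    -- right the coordinate 2 of u₀ and u₄, so only the middle terms survive.
    3d₂²≈c₃ : fromℕ 3 * (d 2F * d 2F) ≈ c 3F
    3d₂²≈c₃ = trans (*-congˡ (sym (only-middle (x≈0⇒xy≈0 a₂≈0) (x≈0⇒xy≈0 e₂≈0))))
      (trans (square 2F 2F) (only-middle c₀≈0 c₄≈0))

    3c₂²≈d₃ : fromℕ 3 * (c 2F * c 2F) ≈ d 3F
    3c₂²≈d₃ = trans (*-congˡ (sym (only-middle (x≈0⇒xy≈0 b₂≈0) (x≈0⇒xy≈0 e₂≈0))))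
      (trans (square 2F 3F) (only-middle d₀≈0 d₄≈0))

    3d₃²≈c₂ : fromℕ 3 * (d 3F * d 3F) ≈ c 2F
    3d₃²≈c₂ = trans (*-congˡ (sym (only-middle (x≈0⇒xy≈0 a₃≈0) (x≈0⇒xy≈0 e₃≈0))))
      (trans (square 3F 2F) (only-middle c₁≈0 c₄≈0))

    a₀²+e₀²≈c₂ : a 0F * a 0F + e 0F * e 0F ≈ c 2F
    a₀²+e₀²≈c₂ = trans (+-congʳ (sym (y≈0⇒x+y≈x (x≈0⇒xy≈0 d₀≈0)))) (u₀² 2F)

    b₀²+e₀²≈d₂ : b 0F * b 0F + e 0F * e 0F ≈ d 2F
    b₀²+e₀²≈d₂ = trans (+-congʳ (sym (y≈0⇒x+y≈x (x≈0⇒xy≈0 c₀≈0)))) (u₀² 3F)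

    b₁²+e₁²≈d₃ : b 1F * b 1F + e 1F * e 1F ≈ d 3F
    b₁²+e₁²≈d₃ = trans (+-congʳ (sym (y≈0⇒x+y≈x (x≈0⇒xy≈0 c₁≈0)))) (u₁² 3F)

    2[a₄²+e₄²]≈c₂+c₃ : fromℕ 2 * (a 4F * a 4F + e 4F * e 4F) ≈ c 2F + c 3F
    2[a₄²+e₄²]≈c₂+c₃ =
      trans (*-congˡ (+-congʳ (sym (y≈0⇒x+y≈x (x≈0⇒xy≈0 d₄≈0))))) (square 4F 2F)

    b₀b₁+e₀e₁≈0 : b 0F * b 1F + e 0F * e 1F ≈ 0#
    b₀b₁+e₀e₁≈0 = trans (+-congʳ (sym (y≈0⇒x+y≈x (x≈0⇒xy≈0 c₀≈0))))
      (orthogonal {0F} {1F} (λ ()) 3F)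

    a₀a₄+e₀e₄≈0 : a 0F * a 4F + e 0F * e 4F ≈ 0#
    a₀a₄+e₀e₄≈0 = trans (+-congʳ (sym (y≈0⇒x+y≈x (x≈0⇒xy≈0 d₀≈0))))
      (orthogonal {0F} {4F} (λ ()) 2F)

    -- The relation 2(a₄² + e₄²) = c₂ + c₃ is to be compared with 3d₃² = c₂. This requires c₃ = a₄ =
    -- 0 and e₄ = d₃; the route to a₄ = 0 goes through e₀ = 0.
    c₂≈0 : c 2F ≈ 0#
    c₂≈0 = ¬#⇒≈ contra
      where
      module _ (c₂#0 : c 2F # 0#) where
        c₃≈0 : c 3F ≈ 0#
        c₃≈0 = xy≈0∧x#0⇒y≈0 (orthogonal {2F} {3F} (λ ()) 0F) c₂#0

        d₂≈0 : d 2F ≈ 0#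
        d₂≈0 = xx≈0⇒x≈0 (xy≈0∧x#0⇒y≈0 (trans 3d₂²≈c₃ c₃≈0) 3#0)

        d₃#0 : d 3F # 0#
        d₃#0 = #-congʳ 3c₂²≈d₃ (x#0y#0→xy#0 3#0 (x#0y#0→xy#0 c₂#0 c₂#0))

        -- b₀² = - e₀² and b₀ b₁ = - e₀ e₁ give e₀² (b₁² + e₁²) = 0; the two
        -- relations are added on both sides so that no subtraction occurs.
        e₀²d₃≈0 : e 0F * e 0F * d 3F ≈ 0#
        e₀²d₃≈0 = begin
          E * E * d 3F
            ≈⟨ *-congˡ b₁²+e₁²≈d₃ ⟨
          E * E * (B′ * B′ + E′ * E′)
            ≈⟨ y≈0⇒x+y≈x (y≈0⇒xy≈0 b₀b₁+e₀e₁≈0) ⟨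
          E * E * (B′ * B′ + E′ * E′) + B * B′ * (B * B′ + E * E′)
            ≈⟨ solve 4 (λ B B′ E E′ →
                 E :* E :* (B′ :* B′ :+ E′ :* E′) :+ B :* B′ :* (B :* B′ :+ E :* E′)
                   := B′ :* B′ :* (B :* B :+ E :* E) :+ E :* E′ :* (B :* B′ :+ E :* E′))
                 refl B B′ E E′ ⟩
          B′ * B′ * (B * B + E * E) + E * E′ * (B * B′ + E * E′)
            ≈⟨ x≈0⇒x+y≈y (y≈0⇒xy≈0 (trans b₀²+e₀²≈d₂ d₂≈0)) ⟩
          E * E′ * (B * B′ + E * E′)
            ≈⟨ y≈0⇒xy≈0 b₀b₁+e₀e₁≈0 ⟩
          0# ∎
          where
          B = b 0F ; B′ = b 1F ; E = e 0F ; E′ = e 1F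

        e₀≈0 : e 0F ≈ 0#
        e₀≈0 = xx≈0⇒x≈0 (xy≈0∧x#0⇒y≈0 (trans (*-comm _ _) e₀²d₃≈0) d₃#0)

        -- With e₀ = 0 the relations become a₀a₄ = 0 and a₀² = c₂, and c₂ is apart from zero.
        a₄≈0 : a 4F ≈ 0#
        a₄≈0 = ¬#⇒≈ λ a₄#0 →
          let a₀≈0 = xy≈0∧x#0⇒y≈0 (trans (*-comm _ _)
                (trans (sym (y≈0⇒x+y≈x (x≈0⇒xy≈0 e₀≈0))) a₀a₄+e₀e₄≈0)) a₄#0
          in ≈⇒¬# (trans (sym a₀²+e₀²≈c₂)
                (trans (x≈0⇒x+y≈y (x≈0⇒xy≈0 a₀≈0)) (x≈0⇒xy≈0 e₀≈0))) c₂#0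

        e₄≈d₃ : e 4F ≈ d 3F
        e₄≈d₃ = begin
          e 4F                                  ≈⟨ only-last e₀≈0 e₃≈0 ⟨
          e 0F + e 3F + e 4F                    ≈⟨ square 2F 4F ⟨
          fromℕ 3 * (c 2F * c 2F + d 2F * d 2F) ≈⟨ *-congˡ (y≈0⇒x+y≈x (x≈0⇒xy≈0 d₂≈0)) ⟩
          fromℕ 3 * (c 2F * c 2F)               ≈⟨ 3c₂²≈d₃ ⟩
          d 3F                                  ∎

        2d₃²≈c₂ : fromℕ 2 * (d 3F * d 3F) ≈ c 2F
        2d₃²≈c₂ = begin
          fromℕ 2 * (d 3F * d 3F)               ≈⟨ *-congˡ (*-cong e₄≈d₃ e₄≈d₃) ⟨
          fromℕ 2 * (e 4F * e 4F)               ≈⟨ *-congˡ (x≈0⇒x+y≈y (x≈0⇒xy≈0 a₄≈0)) ⟨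
          fromℕ 2 * (a 4F * a 4F + e 4F * e 4F) ≈⟨ 2[a₄²+e₄²]≈c₂+c₃ ⟩
          c 2F + c 3F                           ≈⟨ y≈0⇒x+y≈x c₃≈0 ⟩
          c 2F                                  ∎

        -- The coefficients 3 and 2 are the degrees of the vertices 3 and 4; their difference 1
        -- leaves d₃² itself.
        d₃²≈0 : d 3F * d 3F ≈ 0#
        d₃²≈0 = +-cancelˡ (fromℕ 2 * (d 3F * d 3F)) _ _ (begin
          fromℕ 2 * (d 3F * d 3F) + d 3F * d 3F ≈⟨ solve 1 (λ x →
            (con 1 :+ (con 1 :+ con 0)) :* x :+ x := (con 1 :+ (con 1 :+ (con 1 :+ con 0))) :* x)
            refl (d 3F * d 3F) ⟩
          fromℕ 3 * (d 3F * d 3F)               ≈⟨ trans 3d₃²≈c₂ (sym 2d₃²≈c₂) ⟩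
          fromℕ 2 * (d 3F * d 3F)               ≈⟨ +-identityʳ _ ⟨
          fromℕ 2 * (d 3F * d 3F) + 0#          ∎)

        contra : _
        contra = ≈⇒¬# (xx≈0⇒x≈0 d₃²≈0) d₃#0

    d₃≈0 : d 3F ≈ 0#
    d₃≈0 = trans (sym 3c₂²≈d₃) (y≈0⇒xy≈0 (x≈0⇒xy≈0 c₂≈0))

  -- Vanishing of the images

  module Conclusions (2#0 : fromℕ 2 # 0#) (3#0 : fromℕ 3 # 0#)
    {u} (r : BullRelations u) where

    open Relations r
    open Vanishing 2#0 3#0 r
    -- Reflection exchanges `a` with `b` and `c` with `d`: `Mirror.c₂≈0` speaks of `d 2F`, and
    -- `Mirror.d₃≈0` of `c 3F`.
    module Mirror = Vanishing 2#0 3#0 (reflectRelations r)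

    u₂≈0 : ∀ l → u 2F l ≈ 0#
    u₂≈0 0F = a₂≈0
    u₂≈0 1F = b₂≈0
    u₂≈0 2F = c₂≈0
    u₂≈0 3F = Mirror.c₂≈0
    u₂≈0 4F = e₂≈0

    u₃≈0 : ∀ l → u 3F l ≈ 0#
    u₃≈0 0F = a₃≈0
    u₃≈0 1F = b₃≈0
    u₃≈0 2F = Mirror.d₃≈0
    u₃≈0 3F = d₃≈0
    u₃≈0 4F = e₃≈0

    a₄²+e₄²≈0 : a 4F * a 4F + e 4F * e 4F ≈ 0#
    a₄²+e₄²≈0 = xy≈0∧x#0⇒y≈0
      (trans 2[a₄²+e₄²]≈c₂+c₃ (trans (x≈0⇒x+y≈y c₂≈0) Mirror.d₃≈0)) 2#0

    b₄²+e₄²≈0 : b 4F * b 4F + e 4F * e 4F ≈ 0#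
    b₄²+e₄²≈0 = xy≈0∧x#0⇒y≈0
      (trans Mirror.2[a₄²+e₄²]≈c₂+c₃ (trans (x≈0⇒x+y≈y Mirror.c₂≈0) d₃≈0)) 2#0

    -- Each coordinate of u₀, u₁, u₄ still open occurs in a vanishing sum of two squares; commuting
    -- the sum handles the second square.
    u≈0 : ¬ IsSquare (- 1#) → ∀ i l → u i l ≈ 0#
    u≈0 nonsquare = vanishes
      where
      anisotropic : x * x + y * y ≈ 0# → x ≈ 0#
      anisotropic = sumOfSquares-anisotropic nonsquare

      vanishes : ∀ i l → u i l ≈ 0#
      vanishes 0F 0F = anisotropic (trans a₀²+e₀²≈c₂ c₂≈0)
      vanishes 0F 1F = anisotropic (trans b₀²+e₀²≈d₂ Mirror.c₂≈0)
      vanishes 0F 2F = c₀≈0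
      vanishes 0F 3F = d₀≈0
      vanishes 0F 4F = anisotropic (trans (+-comm _ _) (trans a₀²+e₀²≈c₂ c₂≈0))
      vanishes 1F 0F = anisotropic (trans Mirror.b₁²+e₁²≈d₃ Mirror.d₃≈0)
      vanishes 1F 1F = anisotropic (trans b₁²+e₁²≈d₃ d₃≈0)
      vanishes 1F 2F = c₁≈0
      vanishes 1F 3F = d₁≈0
      vanishes 1F 4F = anisotropic (trans (+-comm _ _) (trans b₁²+e₁²≈d₃ d₃≈0))
      vanishes 2F    = u₂≈0
      vanishes 3F    = u₃≈0
      vanishes 4F 0F = anisotropic a₄²+e₄²≈0
      vanishes 4F 1F = anisotropic b₄²+e₄²≈0
      vanishes 4F 2F = c₄≈0
      vanishes 4F 3F = d₄≈0
      vanishes 4F 4F = anisotropic (trans (+-comm _ _) a₄²+e₄²≈0)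

  -- Homomorphisms from the random walk algebra to the graph algebra

  module _ (2#0 : fromℕ 2 # 0#) (3#0 : fromℕ 3 # 0#) where

    private
      ARW = randomWalkAlgebra bull (bullDegree#0 2#0 3#0)
      A   = graphAlgebra bull

    module _ {f} (f-homo : IsAlgebraHomomorphism ARW A f) where
      open Homomorphism (transition bull (bullDegree#0 2#0 3#0)) (adjacency bull) f-homo

      image-relations : BullRelations image
      image-relations = record
        { orthogonal = λ {i} {j} i≢j l →
            trans (sym (sum-adjacency-bull _ l)) (image-orthogonal i≢j l)
        ; square     = λ i l → trans (*-congˡ (sym (sum-adjacency-bull _ l)))
            (trans (degree*image-square bull (bullDegree#0 2#0 3#0) (adjacency bull) f-homo i l)
                   (sum-adjacency-bull _ i))
        }

      open Conclusions 2#0 3#0 image-relations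

      homomorphism-zero : ¬ IsSquare (- 1#) → ∀ x l → f x l ≈ 0#
      homomorphism-zero nonsquare x l = trans (f-expansion x l)
        (trans (sum-cong-≋ λ i → y≈0⇒xy≈0 {x = x i} (u≈0 nonsquare i l)) (sum-replicate-zero 5))

      homomorphism-e₂≈0 : ∀ l → f (basis 2F) l ≈ 0#
      homomorphism-e₂≈0 = u₂≈0

    not-isomorphic : ¬ Isomorphic ARW A
    -- Injectivity would identify `basis 2F` with the zero vector, which at coordinate 2 says
    -- `1# ≈ 0#`.
    not-isomorphic (f , f-iso) = ≈⇒¬# (injective fe₂≈f0 2F) 1#0
      where
      open IsAlgebraIsomorphism f-iso
      injective = proj₁ bijective
      fe₂≈f0 : ∀ l → f (basis 2F) l ≈ f (λ _ → 0#) l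
      fe₂≈f0 l = trans (homomorphism-e₂≈0 isAlgebraHomomorphism l) (sym (0ᴹ-homo l))

mainTheorem4 :
    ∀ {c ℓ₁ ℓ₂} →
    TwinFree bull
    × Singular bull
    × ((K : HeytingField c ℓ₁ ℓ₂) →
       let open HeytingField K
           open OverField K
       in
       (2#0 : fromℕ 2 # 0#) (3#0 : fromℕ 3 # 0#) →
       let ARW = randomWalkAlgebra bull (bullDegree#0 2#0 3#0)
           A   = graphAlgebra bull
       in
       (¬ IsSquare (- 1#) →
         ∀ f → IsAlgebraHomomorphism ARW A f →
         ∀ x → RawAlgebra._≈ᴹ_ A (f x) (RawAlgebra.0ᴹ A))
       × ¬ Isomorphic ARW A)
mainTheorem4 = bull-twinFree , bull-singular , λ K 2#0 3#0 →
  (λ nonsquare f f-homo → homomorphism-zero K 2#0 3#0 f-homo nonsquare) ,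
  not-isomorphic K 2#0 3#0
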